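{- Let $A$ be the simple graph with vertex set $\{1,2,3,4,5,6,7\}$ and exactly the following $12$ edges: $\{1,2\}$, $\{1,3\}$, $\{1,6\}$, $\{2,4\}$, $\{2,5\}$, $\{3,7\}$, $\{4,7\}$, $\{5,7\}$, $\{6,7\}$, $\{3,4\}$, $\{4,5\}$, $\{5,6\}$. Then $A$ is not word-representable. In particular, not all graphs of vertex degree at most $4$ are word-representable.
   Context: Graphs are finite and simple. Distinct letters $x$ and $y$ alternate in a word $w$ if deleting all other letters from $w$ results in a word of the form $xyxy\cdots$ or $yxyx\cdots$ (of even or odd length). A graph $G=(V,E)$ is word-representable if there exists a finite word $w$ over the alphabet $V$, in which each letter of $V$ occurs at least once, such that for all distinct $x,y\in V$, the letters $x$ and $y$ alternate in $w$ if and only if $\{x,y\}\in E$. -}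

module Defs where

open import Data.Fin using (Fin; toℕ; _≟_)
open import Data.Fin.Properties using (all?)
open import Data.List using (List; []; _∷_; filter; length; allFin)
open import Data.List.Membership.Propositional using (_∈_)
import Data.List.Membership.DecPropositional as DecMembership
open import Data.Nat as ℕ using (ℕ; zero; suc)
open import Data.Product using (_×_; _,_; ∃-syntax)
open import Data.Product.Properties using (≡-dec)
open import Data.Sum using (_⊎_; swap)
open import Function.Bundles using (_⇔_)
open import Level using (0ℓ)
open import Relation.Binary.Core using (Rel)
open import Relation.Binary.Definitions using (Decidable; Irreflexive; Symmetric)
open import Relation.Binary.PropositionalEquality using (_≡_; _≢_; refl)
open import Relation.Nullary.Decidable using (¬?; _⊎-dec_; from-yes)

record Graph (n : ℕ) : Set₁ where
  field
    Adj    : Rel (Fin n) 0ℓ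
    adj?   : Decidable Adj
    sym    : Symmetric Adj
    irrefl : Irreflexive _≡_ Adj

  degree : Fin n → ℕ
  degree v = length (filter (adj? v) (allFin n))

-- The word x y x y ⋯ of the given length.
alternating : ∀ {n} → Fin n → Fin n → ℕ → List (Fin n)
alternating x y zero    = []
alternating x y (suc k) = x ∷ alternating y x k

restrict : ∀ {n} → Fin n → Fin n → List (Fin n) → List (Fin n)
restrict x y = filter (λ z → (z ≟ x) ⊎-dec (z ≟ y))

Alternate : ∀ {n} → Fin n → Fin n → List (Fin n) → Set
Alternate x y w =
  ∃[ k ] (restrict x y w ≡ alternating x y k ⊎ restrict x y w ≡ alternating y x k)

WordRepresentable : ∀ {n} → Graph n → Set
WordRepresentable {n} G =
  ∃[ w ] ((∀ (v : Fin n) → v ∈ w)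
        × (∀ (x y : Fin n) → x ≢ y → Alternate x y w ⇔ Graph.Adj G x y))

edgesA : List (ℕ × ℕ)
edgesA =
  (1 , 2) ∷ (1 , 3) ∷ (1 , 6) ∷ (2 , 4) ∷ (2 , 5) ∷ (3 , 7) ∷
  (4 , 7) ∷ (5 , 7) ∷ (6 , 7) ∷ (3 , 4) ∷ (4 , 5) ∷ (5 , 6) ∷ []

-- The elements 0, …, 6 of Fin 7 stand for the vertices 1, …, 7.
label : Fin 7 → ℕ
label v = suc (toℕ v)

AdjA : Rel (Fin 7) 0ℓ
AdjA u v = (label u , label v) ∈ edgesA ⊎ (label v , label u) ∈ edgesA

adjA? : Decidable AdjA
adjA? u v = ((label u , label v) ∈? edgesA) ⊎-dec ((label v , label u) ∈? edgesA)
  where open DecMembership (≡-dec ℕ._≟_ ℕ._≟_) using (_∈?_)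

graphA : Graph 7
graphA = record
  { Adj    = AdjA
  ; adj?   = adjA?
  ; sym    = swap
  ; irrefl = λ { {v} refl → from-yes (all? (λ u → ¬? (adjA? u u))) v }
  }

{-# OPTIONS --safe #-}

-- In a word w representing a graph, orient each edge x y towards the letter
-- that starts later. Then x ⟶ y says that in every prefix of w the letter x
-- occurs as often as y or once more. Such an orientation has no directed
-- cycle, and if a ⟶ b ⟶ c ⟶ d with a adjacent to d, then comparing the counts
-- around the path shows that also a c and b d alternate. Hence in a 4-cycle
-- a b c d that is not a clique, a ⟶ b ⟶ c forces a ⟶ d ⟶ c. Whichever of the
-- vertices 4, 5, 7 is the middle one of the triangle 4 5 7, this rule leads to a
-- contradiction; reversing all arrows and the reflection 3 ↔ 6, 4 ↔ 5 of the
-- graph reduce the six cases to the two directed paths 4 ⟶ 5 ⟶ 7 and 4 ⟶ 7 ⟶ 5.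
module Submission where

open import Defs
open import Data.Nat using (ℕ; _≤_)
open import Data.Fin using (Fin)
open import Data.Product using (_×_)
open import Relation.Nullary using (¬_)

open import Data.Empty using (⊥; ⊥-elim)
open import Data.Fin using (zero; suc; _≟_)
open import Data.Fin.Properties using (all?)
open import Data.List using (List; []; _∷_; filter; length; take)
open import Data.List.Membership.Propositional using (_∈_)
open import Data.List.Properties using (∷-injective; filter-≐)
open import Data.List.Relation.Unary.Any using (here; there)
open import Data.Nat using (zero; suc; z≤n; s≤s; s≤s⁻¹; _≤?_)
open import Data.Nat.Properties using (≤-refl; ≤-trans)
open import Data.Product using (_,_; proj₁; proj₂; ∃-syntax)
open import Data.Sum as Sum using (_⊎_; inj₁; inj₂)
open import Function.Base using (_∘_)
open import Function.Bundles using (Equivalence)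
open import Relation.Binary.PropositionalEquality
  using (_≡_; _≢_; refl; sym; trans; cong)
open import Relation.Nullary.Decidable
  using (yes; no; True; toWitness; from-yes; ¬?; _×-dec_; _→-dec_)

-- Orientations without directed triangles and short shortcuts.

private variable
  n : ℕ

-- A weak form of semi-transitive orientation, limited to triangles and three-edge paths. In
-- `no-shortcut` the direction of the edge `a d` stays open, so directed 4-cycles are covered too.
record ShortcutFree (G : Graph n) : Set₁ where
  open Graph G using (Adj; adj?) renaming (sym to Adj-sym)
  infix 4 _⟶_
  field
    _⟶_         : Fin n → Fin n → Set
    orient      : ∀ {x y} → Adj x y → x ⟶ y ⊎ y ⟶ x
    acyclic₃    : ∀ {x y z} → x ⟶ y → y ⟶ z → ¬ z ⟶ x
    no-shortcut : ∀ {a b c d} → a ⟶ b → b ⟶ c → c ⟶ d → Adj a d → Adj a c × Adj b d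

  orientation : ∀ x y → {True (adj? x y)} → x ⟶ y ⊎ y ⟶ x
  orientation x y {e} = orient (toWitness e)

  shortcut-⊥ : ∀ {a b c d} → a ⟶ b → b ⟶ c → c ⟶ d →
    {True (adj? a d ×-dec ¬? (adj? a c ×-dec adj? b d))} → ⊥
  shortcut-⊥ ab bc cd {t} with toWitness t
  ... | ad , notClique = notClique (no-shortcut ab bc cd ad)

  -- If `d ⟶ a`, then `d a b c` is a directed path with adjacent ends; if `c ⟶ d`, then `a b c d` is
  -- one. Either way `no-shortcut` would supply both diagonals.
  square : ∀ {a b c} → a ⟶ b → b ⟶ c → ∀ d →
    {True ((adj? a d ×-dec adj? d c) ×-dec ¬? (adj? a c ×-dec adj? b d))} →
    a ⟶ d × d ⟶ c
  square {a} {b} {c} ab bc d {t} with toWitness t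
  ... | (a~d , d~c) , notClique = first (orient a~d) , second (orient d~c)
    where
    first : a ⟶ d ⊎ d ⟶ a → a ⟶ d
    first (inj₁ ad) = ad
    first (inj₂ da) with no-shortcut da ab bc d~c
    ... | d~b , a~c = ⊥-elim (notClique (a~c , Adj-sym d~b))

    second : d ⟶ c ⊎ c ⟶ d → d ⟶ c
    second (inj₁ dc) = dc
    second (inj₂ cd) = ⊥-elim (notClique (no-shortcut ab bc cd a~d))

reverse : {G : Graph n} → ShortcutFree G → ShortcutFree G
reverse {G = G} S = record
  { _⟶_         = λ x y → y ⟶ x
  ; orient      = Sum.swap ∘ orient
  ; acyclic₃    = λ yx zy xz → acyclic₃ zy yx xz
  ; no-shortcut = λ ba cb dc a~d → let d~b , c~a = no-shortcut dc cb ba (Adj-sym a~d)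
                                   in Adj-sym c~a , Adj-sym d~b
  }
  where
  open ShortcutFree S
  open Graph G using () renaming (sym to Adj-sym)

pullback : {G : Graph n} (σ : Fin n → Fin n) →
  (∀ x y → Graph.Adj G x y → Graph.Adj G (σ x) (σ y)) →
  (∀ x y → Graph.Adj G (σ x) (σ y) → Graph.Adj G x y) →
  ShortcutFree G → ShortcutFree G
pullback σ preserves reflects S = record
  { _⟶_         = λ x y → σ x ⟶ σ y
  ; orient      = orient ∘ preserves _ _
  ; acyclic₃    = acyclic₃
  ; no-shortcut = λ ab bc cd a~d →
      let σa~σc , σb~σd = no-shortcut ab bc cd (preserves _ _ a~d)
      in reflects _ _ σa~σc , reflects _ _ σb~σd
  }
  where open ShortcutFree S

-- Letter counts in prefixes.

count : Fin n → List (Fin n) → ℕ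
count x w = length (filter (_≟ x) w)

infix 4 _≽[_]_
_≽[_]_ : Fin n → List (Fin n) → Fin n → Set
x ≽[ w ] y = ∀ k → count y (take k w) ≤ count x (take k w)

Leads : Fin n → Fin n → List (Fin n) → Set
Leads x y w = ∀ k → count y (take k w) ≤ count x (take k w)
                  × count x (take k w) ≤ suc (count y (take k w))

-- If the letters differ, the first occurrence of either in `w` ends a prefix with counts 1 and 0,
-- refuting one comparison; `x ∈ w` guarantees such an occurrence.
≽-antisym : {x y : Fin n} (w : List (Fin n)) → x ∈ w → x ≽[ w ] y → y ≽[ w ] x → x ≡ y
≽-antisym {x = x} {y} (z ∷ w) x∈zw x≽y y≽x
  with z ≟ x | z ≟ y | x≽y 1 | y≽x 1 | (λ k → x≽y (suc k)) | (λ k → y≽x (suc k))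
... | yes refl | yes refl | _  | _  | _    | _    = refl
... | yes _    | no _     | _  | () | _    | _
... | no _     | yes _    | () | _  | _    | _
... | no z≢x   | no _     | _  | _  | x≽y′ | y≽x′ with x∈zw
...   | here x≡z  = ⊥-elim (z≢x (sym x≡z))
...   | there x∈w = ≽-antisym w x∈w x≽y′ y≽x′

restrict-comm : (x y : Fin n) (w : List (Fin n)) → restrict x y w ≡ restrict y x w
restrict-comm x y = filter-≐ _ _ (Sum.swap , Sum.swap)

alternating⇒leads : {x y : Fin n} → x ≢ y → ∀ w m →
  restrict x y w ≡ alternating x y m → Leads x y w
alternating⇒leads x≢y w       m eq zero    = z≤n , z≤n
alternating⇒leads x≢y []      m eq (suc k) = z≤n , z≤n
alternating⇒leads {x = x} {y} x≢y (z ∷ w) m eq (suc k) with z ≟ x | z ≟ y | m | eq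
... | yes refl | yes refl | _     | _   = ⊥-elim (x≢y refl)
... | no _     | no _     | m     | eq′ = alternating⇒leads x≢y w m eq′ k
... | no z≢x   | yes _    | suc _ | eq′ = ⊥-elim (z≢x (proj₁ (∷-injective eq′)))
-- Past a leading `x` the word alternates from `y`: with the roles swapped the two bounds trade
-- places, and the leading `x` accounts for the shift by one.
... | yes refl | no _     | suc m | eq′
  with p , q ← alternating⇒leads (x≢y ∘ sym) w m
                 (trans (restrict-comm y x w) (proj₂ (∷-injective eq′))) k
  = q , s≤s p

leads⇒alternating : {x y : Fin n} → x ≢ y → ∀ w → Leads x y w →
  ∃[ m ] restrict x y w ≡ alternating x y m
leads⇒alternating x≢y [] _ = 0 , refl
leads⇒alternating {x = x} {y} x≢y (z ∷ w) x⟶y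
  with z ≟ x | z ≟ y | x⟶y 1 | (λ k → x⟶y (suc k))
... | yes refl | yes refl | _      | _    = ⊥-elim (x≢y refl)
... | no _     | yes _    | () , _ | _
... | no _     | no _     | _      | x⟶y′ = leads⇒alternating x≢y w x⟶y′
... | yes refl | no _     | _      | x⟶y′
  with m , eq ← leads⇒alternating (x≢y ∘ sym) w
                  (λ k → let p , q = x⟶y′ k in s≤s⁻¹ q , p)
  = suc m , cong (z ∷_) (trans (restrict-comm x y w) eq)

shortcutFree : (G : Graph n) → WordRepresentable G → ShortcutFree G
shortcutFree {n} G (w , occurs , represents) = record
  { _⟶_         = _⟶_
  ; orient      = orient
  ; acyclic₃    = λ { (xy , xLy) (_ , yLz) (_ , zLx) →
                      no-cycle xy (≽-of xLy) (≽-trans (≽-of yLz) (≽-of zLx)) }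
  ; no-shortcut = no-shortcut
  }
  where
  open Graph G using (Adj; irrefl) renaming (sym to Adj-sym)

  infix 4 _⟶_
  _⟶_ : Fin n → Fin n → Set
  x ⟶ y = Adj x y × Leads x y w

  ≽-of : ∀ {x y} → Leads x y w → x ≽[ w ] y
  ≽-of xLy k = proj₁ (xLy k)

  ≽-trans : ∀ {x y z} → x ≽[ w ] y → y ≽[ w ] z → x ≽[ w ] z
  ≽-trans x≽y y≽z k = ≤-trans (y≽z k) (x≽y k)

  no-cycle : ∀ {x y} → Adj x y → x ≽[ w ] y → ¬ y ≽[ w ] x
  no-cycle {x} xy x≽y y≽x = irrefl (≽-antisym w (occurs x) x≽y y≽x) xy

  orient : ∀ {x y} → Adj x y → x ⟶ y ⊎ y ⟶ x
  orient {x} {y} xy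
    with Equivalence.from (represents x y (λ x≡y → irrefl x≡y xy)) xy
  ... | m , inj₁ eq =
    inj₁ (xy , alternating⇒leads (λ x≡y → irrefl x≡y xy) w m eq)
  ... | m , inj₂ eq =
    inj₂ (Adj-sym xy , alternating⇒leads (λ y≡x → irrefl (sym y≡x) xy) w m
                         (trans (restrict-comm y x w) eq))

  leads⇒adj : ∀ {x y} → x ≢ y → Leads x y w → Adj x y
  leads⇒adj {x} {y} x≢y xLy with m , eq ← leads⇒alternating x≢y w xLy =
    Equivalence.to (represents x y x≢y) (m , inj₁ eq)

  no-shortcut : ∀ {a b c d} → a ⟶ b → b ⟶ c → c ⟶ d → Adj a d → Adj a c × Adj b d
  no-shortcut {a} {b} {c} {d} (ab , aLb) (bc , bLc) (cd , cLd) a~d with orient a~d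
  ... | inj₂ (_ , dLa) = ⊥-elim
    (no-cycle ab (≽-of aLb) (≽-trans (≽-of bLc) (≽-trans (≽-of cLd) (≽-of dLa))))
  ... | inj₁ (_ , aLd) =
      -- The counts of `b` and `c` lie between those of `a` and `d`, which differ by at most one.
      -- Equality of `a` and `c`, or of `b` and `d`, would give a directed 2-cycle.
      leads⇒adj (λ { refl → no-cycle ab (≽-of aLb) (≽-of bLc) })
        (λ k → a≽c k , ≤-trans (proj₂ (aLd k)) (s≤s (≽-of cLd k)))
    , leads⇒adj (λ { refl → no-cycle bc (≽-of bLc) (≽-of cLd) })
        (λ k → b≽d k , ≤-trans (≽-of aLb k) (proj₂ (aLd k)))
    where
    a≽c : a ≽[ w ] c
    a≽c = ≽-trans (≽-of aLb) (≽-of bLc)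
    b≽d : b ≽[ w ] d
    b≽d = ≽-trans (≽-of bLc) (≽-of cLd)

-- Case analysis on the seven-vertex graph.

pattern v₁ = zero
pattern v₂ = suc v₁
pattern v₃ = suc v₂
pattern v₄ = suc v₃
pattern v₅ = suc v₄
pattern v₆ = suc v₅
pattern v₇ = suc v₆

reflection : Fin 7 → Fin 7
reflection v₃ = v₆
reflection v₄ = v₅
reflection v₅ = v₄
reflection v₆ = v₃
reflection v  = v

reflect : ShortcutFree graphA → ShortcutFree graphA
reflect = pullback reflection
  (from-yes (all? λ x → all? λ y → adjA? x y →-dec adjA? (reflection x) (reflection y)))
  (from-yes (all? λ x → all? λ y → adjA? (reflection x) (reflection y) →-dec adjA? x y))

module _ (S : ShortcutFree graphA) where
  open ShortcutFree S

  -- Opposite directions at 2 on its edges to 4 and 5 close a triangle or make 4 2 5 7 a shortcut.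
  -- If 2 is a source or a sink for both, squares through 1 propagate the arrows until a shortcut
  -- appears.
  ¬4⟶5⟶7 : v₄ ⟶ v₅ → ¬ v₅ ⟶ v₇
  ¬4⟶5⟶7 e45 e57 with square e45 e57 v₃
  ... | e43 , e37 = vertex-2 (orientation v₂ v₄) (orientation v₂ v₅)
    where
    6⟶5-if-6⟶7 : v₆ ⟶ v₇ → v₆ ⟶ v₅
    6⟶5-if-6⟶7 e67 with orientation v₆ v₅
    ... | inj₁ e65 = e65
    ... | inj₂ e56 = ⊥-elim (shortcut-⊥ e45 e56 e67)

    source : v₂ ⟶ v₄ → v₂ ⟶ v₅ → ⊥
    source e24 e25 =
      let e21 , e13 = square e24 e43 v₁
          e16 , e67 = square e13 e37 v₆
      in shortcut-⊥ e21 e16 (6⟶5-if-6⟶7 e67)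

    sink : v₄ ⟶ v₂ → v₅ ⟶ v₂ → ⊥
    sink e42 e52 with orientation v₆ v₇
    ... | inj₁ e67 with square (6⟶5-if-6⟶7 e67) e52 v₁
    ...   | e61 , e12 with orientation v₁ v₃
    ...     | inj₁ e13 = shortcut-⊥ e61 e13 e37
    ...     | inj₂ e31 = shortcut-⊥ e43 e31 e12
    sink e42 e52 | inj₂ e76 =
      let e31 , e16 = square e37 e76 v₁
          _   , e21 = square e43 e31 v₂
      in shortcut-⊥ e52 e21 e16

    vertex-2 : v₂ ⟶ v₄ ⊎ v₄ ⟶ v₂ → v₂ ⟶ v₅ ⊎ v₅ ⟶ v₂ → ⊥
    vertex-2 (inj₁ e24) (inj₁ e25) = source e24 e25
    vertex-2 (inj₁ e24) (inj₂ e52) = acyclic₃ e45 e52 e24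
    vertex-2 (inj₂ e42) (inj₁ e25) = shortcut-⊥ e42 e25 e57
    vertex-2 (inj₂ e42) (inj₂ e52) = sink e42 e52

module _ (S : ShortcutFree graphA) where
  open ShortcutFree S

  -- Three squares force the path 3 1 6 5; then either direction of the edge 6 7 completes a
  -- shortcut, 3 1 6 7 or 4 7 6 5.
  4⟶7⟶5⇒¬3⟶4 : v₄ ⟶ v₇ → v₇ ⟶ v₅ → ¬ v₃ ⟶ v₄
  4⟶7⟶5⇒¬3⟶4 e47 e75 e34
    with e42 , e25 ← square e47 e75 v₂
    with e31 , e12 ← square e34 e42 v₁
    with e16 , e65 ← square e12 e25 v₆
    with orientation v₆ v₇
  ... | inj₁ e67 = shortcut-⊥ e31 e16 e67
  ... | inj₂ e76 = shortcut-⊥ e47 e76 e65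

module _ (S : ShortcutFree graphA) where
  open ShortcutFree S

  ¬4⟶7⟶5 : v₄ ⟶ v₇ → ¬ v₇ ⟶ v₅
  ¬4⟶7⟶5 e47 e75 with orientation v₃ v₄ | orientation v₅ v₆
  ... | inj₁ e34 | _        = 4⟶7⟶5⇒¬3⟶4 S e47 e75 e34
  -- Reflection followed by reversal preserves the path 4 7 5 and turns 5 ⟶ 6 into 3 ⟶ 4.
  ... | inj₂ _   | inj₁ e56 = 4⟶7⟶5⇒¬3⟶4 (reverse (reflect S)) e75 e47 e56
  ... | inj₂ e43 | inj₂ e65 with orientation v₃ v₇ | orientation v₆ v₇
  ...   | inj₁ e37 | _        = shortcut-⊥ e43 e37 e75
  ...   | inj₂ _   | inj₂ e76 = shortcut-⊥ e47 e76 e65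
  -- Both squares end at the edge 1 2, whose two directions give the shortcuts 6 1 2 5 and 4 2 1 3.
  ...   | inj₂ e73 | inj₁ e67
    with e61 , e13 ← square e67 e73 v₁
    with e42 , e25 ← square e47 e75 v₂
    with orientation v₁ v₂
  ...     | inj₁ e12 = shortcut-⊥ e61 e12 e25
  ...     | inj₂ e21 = shortcut-⊥ e42 e21 e13

module _ (S : ShortcutFree graphA) where
  open ShortcutFree S

  ¬4⟶5 : ¬ v₄ ⟶ v₅
  ¬4⟶5 e45 with orientation v₅ v₇ | orientation v₄ v₇
  ... | inj₁ e57 | _        = ¬4⟶5⟶7 S e45 e57
  ... | inj₂ e75 | inj₁ e47 = ¬4⟶7⟶5 S e47 e75
  -- The same symmetry fixes 4 ⟶ 5 and turns 7 ⟶ 4 into 5 ⟶ 7.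
  ... | inj₂ _   | inj₂ e74 = ¬4⟶5⟶7 (reverse (reflect S)) e45 e74

graphA-not-shortcutFree : ¬ ShortcutFree graphA
graphA-not-shortcutFree S with ShortcutFree.orientation S v₄ v₅
... | inj₁ e45 = ¬4⟶5 S e45
... | inj₂ e54 = ¬4⟶5 (reflect S) e54

mainTheorem2 : ¬ WordRepresentable graphA
    × ¬ (∀ (n : ℕ) (G : Graph n) → (∀ (v : Fin n) → Graph.degree G v ≤ 4) → WordRepresentable G)
mainTheorem2 = ¬representable , λ representable →
    ¬representable (representable 7 graphA (from-yes (all? λ v → Graph.degree graphA v ≤? 4)))
  where
  ¬representable : ¬ WordRepresentable graphA
  ¬representable = graphA-not-shortcutFree ∘ shortcutFree graphA
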